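{- Let $G$ be a multigraph (multiple edges allowed, no loops) with maximum degree $\Delta(G)$, and let the palette be $\mathcal{K}=\{1,\dots,\lfloor \tfrac32\Delta(G)+\tfrac12\rfloor\}$. Let $M\subseteq E(G)$ be a matching whose edges are assigned arbitrary colours from $\mathcal{K}$. Then this precolouring can be extended to a proper edge-colouring of all of $G$ using only colours from $\mathcal{K}$.
   Context: A proper edge-colouring assigns colours to edges so that any two edges sharing an end-vertex (including parallel edges) receive distinct colours. Extending a precolouring means producing a proper edge-colouring of all of $G$ agreeing with the given colours on the precoloured edges. -}

module Defs where

open import Data.Nat using (ℕ; zero; suc; _+_; _*_; _⊔_; _/_)
open import Data.Fin using (Fin)
open import Data.Fin.Properties using (_≟_)
open import Data.Product using (_×_; _,_; proj₁; proj₂)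
open import Data.Bool using (Bool; true; false)
open import Data.List using (List; map; foldr; sum; length; filter)
open import Data.List using (allFin)
open import Data.Sum using (_⊎_)
open import Relation.Nullary using (¬_; Dec; yes; no)
open import Relation.Nullary.Decidable using (_⊎-dec_)
open import Relation.Binary.PropositionalEquality using (_≡_)

record Multigraph : Set where
  field
    n     : ℕ
    m     : ℕ
    ends  : Fin m → Fin n × Fin n
    loopless : (e : Fin m) → ¬ (proj₁ (ends e) ≡ proj₂ (ends e))

open Multigraph public

Incident : (G : Multigraph) → Fin (m G) → Fin (n G) → Set
Incident G e v = (proj₁ (ends G e) ≡ v) ⊎ (proj₂ (ends G e) ≡ v)

incident? : (G : Multigraph) → (e : Fin (m G)) → (v : Fin (n G)) → Dec (Incident G e v)
incident? G e v = (proj₁ (ends G e) ≟ v) ⊎-dec (proj₂ (ends G e) ≟ v)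

Adjacent : (G : Multigraph) → Fin (m G) → Fin (m G) → Set
Adjacent G e f = Incident G f (proj₁ (ends G e)) ⊎ Incident G f (proj₂ (ends G e))

-- degree of v: number of edges incident with v (no loops, so each counts once)
degree : (G : Multigraph) → Fin (n G) → ℕ
degree G v = length (filter (λ e → incident? G e v) (allFin (m G)))

-- maximum degree Δ(G) (0 for the graph with no vertices)
maxDegree : Multigraph → ℕ
maxDegree G = foldr _⊔_ 0 (map (degree G) (allFin (n G)))

-- size of the palette: ⌊ (3/2) Δ + 1/2 ⌋ = ⌊ (3Δ + 1) / 2 ⌋
paletteSize : Multigraph → ℕ
paletteSize G = (3 * maxDegree G + 1) / 2

EdgeSet : Multigraph → Set
EdgeSet G = Fin (m G) → Bool

IsMatching : (G : Multigraph) → EdgeSet G → Set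
IsMatching G M = (e f : Fin (m G)) → M e ≡ true → M f ≡ true →
                 ¬ (e ≡ f) → ¬ Adjacent G e f

-- an edge-colouring with colours Fin k (colour i stands for i+1)
EdgeColouring : Multigraph → ℕ → Set
EdgeColouring G k = Fin (m G) → Fin k

IsProper : (G : Multigraph) → {k : ℕ} → EdgeColouring G k → Set
IsProper G c = (e f : Fin (m G)) → ¬ (e ≡ f) → Adjacent G e f → ¬ (c e ≡ c f)

{-# OPTIONS --safe #-}
module Submission where

-- We may assume Δ ≥ 2, as otherwise no two edges are adjacent. Let X = ⌈Δ/2⌉ and D = ⌊Δ/2⌋ ≥ 1, so that
-- the palette has D + 2X colours. Delete M and take a cut that no single vertex can improve by switching:
-- at each vertex v the number x v of edges that lie in M or do not cross the cut is at most X. The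
-- non-crossing edges are coloured greedily, after which a crossing edge uw still has at least
-- D + y u + y w free colours, where y = X − x, while v has at most D + y v crossing edges.
-- These are coloured from their lists by Galvin's method (stable matchings as kernels). The preferences
-- come from setting aside y v edges at each vertex v, which are preferred there to all the others, and
-- colouring the remaining bipartite graph with D colours by Kőnig's theorem; then the edges preferred
-- to uw at its two ends number at most y u + y w + D − 1.

open import Defs
open import Data.Bool using (Bool; true; false; not; if_then_else_)
open import Data.Bool.Properties using (¬-not; not-¬; not-involutive)
open import Data.Empty using (⊥-elim)
open import Data.Fin using (Fin; zero; suc; toℕ; fromℕ<; opposite)
open import Data.Fin.Properties using (_≟_; any?; all?; suc-injective; toℕ-fromℕ<; toℕ-injective; toℕ<n;
  opposite-prop; opposite-involutive; ¬∀⟶∃¬)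
open import Data.List using (length; filter; tabulate)
open import Data.List.Membership.Propositional using (lose)
open import Data.List.Membership.Propositional.Properties using (∈-map⁺; ∈-allFin)
open import Data.List.Properties using (foldr-preservesᵒ)
open import Data.Nat using (ℕ; zero; suc; _+_; _*_; _∸_; _≤_; _<_; z≤n; s≤s; z<s; s≤s⁻¹; _<?_; _≤?_; _/_;
  ⌊_/2⌋; ⌈_/2⌉)
open import Data.Nat.Properties hiding (_≟_; suc-injective)
open import Data.Nat.DivMod using (m*n/n≡m; /-monoˡ-≤)
open import Data.Nat.Solver using (module +-*-Solver)
open import Data.Nat.Induction using (<-wellFounded)
open import Data.Product using (Σ; ∃; _×_; _,_; proj₁; proj₂)
open import Data.Sum using (_⊎_; inj₁; inj₂; [_,_]′)
import Data.Bool as Bool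
import Data.Sum as Sum
open import Data.Sum.Properties using (≡-dec)
open import Data.Vec.Functional using (_∷_)
open import Data.Unit using (tt)
open import Function using (_∘_; id; case_of_)
open import Induction.WellFounded using (Acc; acc)
open import Relation.Binary.Definitions using (DecidableEquality; Symmetric; tri<; tri≈; tri>)
open import Relation.Binary.PropositionalEquality
open import Relation.Nullary using (¬_; Dec; yes; no; contradiction)
open import Relation.Nullary.Decidable using (_×-dec_; _⊎-dec_; ¬?)
open import Relation.Unary using (Decidable)
open import Algebra.Properties.CommutativeSemigroup +-commutativeSemigroup using (interchange)

private variable
  N k : ℕ
  P Q R : Fin N → Set

-- Counting

ind : {A : Set} → Dec A → ℕ
ind (yes _) = 1
ind (no _)  = 0

# : {P : Fin N → Set} → Decidable P → ℕ
# {zero}  P? = 0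
# {suc N} P? = ind (P? zero) + # (P? ∘ suc)

#-⊎ : (P? : Decidable P) (Q? : Decidable Q) (R? : Decidable R) →
      (∀ {i} → P i → Q i ⊎ R i) → # P? ≤ # Q? + # R?
#-⊎ {zero}  P? Q? R? f = z≤n
#-⊎ {suc N} P? Q? R? f =
  ≤-trans (+-mono-≤ head (#-⊎ (P? ∘ suc) (Q? ∘ suc) (R? ∘ suc) f))
          (≤-reflexive (interchange (ind (Q? zero)) _ _ _))
  where
  head : ind (P? zero) ≤ ind (Q? zero) + ind (R? zero)
  head with P? zero | Q? zero | R? zero
  ... | no _  | _      | _      = z≤n
  ... | yes _ | yes _  | _      = s≤s z≤n
  ... | yes _ | no _   | yes _  = s≤s z≤n
  ... | yes p | no ¬q  | no ¬r  = ⊥-elim ([ ¬q , ¬r ]′ (f p))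

#-disjoint : (P? : Decidable P) (Q? : Decidable Q) (R? : Decidable R) →
             (∀ {i} → P i → ¬ Q i) → (∀ {i} → P i ⊎ Q i → R i) → # P? + # Q? ≤ # R?
#-disjoint {zero}  P? Q? R? d f = z≤n
#-disjoint {suc N} P? Q? R? d f =
  ≤-trans (≤-reflexive (interchange (ind (P? zero)) _ _ _))
          (+-mono-≤ head (#-disjoint (P? ∘ suc) (Q? ∘ suc) (R? ∘ suc) d f))
  where
  head : ind (P? zero) + ind (Q? zero) ≤ ind (R? zero)
  head with P? zero | Q? zero | R? zero
  ... | yes p | yes q | _     = ⊥-elim (d p q)
  ... | yes p | no _  | yes _ = s≤s z≤n
  ... | yes p | no _  | no ¬r = ⊥-elim (¬r (f (inj₁ p)))
  ... | no _  | yes q | yes _ = s≤s z≤n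
  ... | no _  | yes q | no ¬r = ⊥-elim (¬r (f (inj₂ q)))
  ... | no _  | no _  | _     = z≤n

#-mono : (P? : Decidable P) (Q? : Decidable Q) → (∀ {i} → P i → Q i) → # P? ≤ # Q?
#-mono P? Q? f =
  ≤-trans (m≤m+n _ _) (#-disjoint P? (λ _ → no id) Q? (λ _ ()) [ f , ⊥-elim ]′)

#-positive : (P? : Decidable P) {j : Fin N} → P j → 0 < # P?
#-positive P? {zero} p with P? zero
... | yes _ = z<s
... | no ¬p = ⊥-elim (¬p p)
#-positive P? {suc j} p = ≤-trans (#-positive (P? ∘ suc) p) (m≤n+m _ _)

#-strict : (P? : Decidable P) (Q? : Decidable Q) {j : Fin N} →
           (∀ {i} → P i → Q i) → Q j → ¬ P j → # P? < # Q?
#-strict P? Q? {j} f q ¬p =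
  ≤-trans (+-monoˡ-≤ (# P?) (#-positive (_≟ j) refl))
          (#-disjoint (_≟ j) P? Q? (λ { refl → ¬p }) [ (λ { refl → q }) , f ]′)

#-full : # {N} (λ _ → yes tt) ≡ N
#-full {zero}  = refl
#-full {suc N} = cong suc #-full

#-≤N : (P? : Decidable {A = Fin N} P) → # P? ≤ N
#-≤N P? = ≤-trans (#-mono P? (λ _ → yes tt) _) (≤-reflexive #-full)

_─_ : (Fin N → Set) → Fin N → Fin N → Set
(P ─ j) i = P i × i ≢ j

_─?_ : Decidable P → (j : Fin N) → Decidable (P ─ j)
(P? ─? j) i = P? i ×-dec ¬? (i ≟ j)

#-─ : (P? : Decidable P) {j : Fin N} → P j → # (P? ─? j) < # P?
#-─ P? {j} p = #-strict (P? ─? j) P? proj₁ p (λ q → proj₂ q refl)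

#-injection : {P : Fin N → Set} {Q : Fin k → Set} (P? : Decidable P) (Q? : Decidable Q)
              (_~_ : Fin N → Fin k → Set) →
              (∀ i → P i → ∃ λ j → Q j × i ~ j) → (∀ {i i′ j} → i ~ j → i′ ~ j → i ≡ i′) →
              # P? ≤ # Q?
#-injection {zero}  P? Q? _~_ f inj = z≤n
#-injection {suc N} P? Q? _~_ f inj with P? zero
... | no _ = #-injection (P? ∘ suc) Q? (_~_ ∘ suc) (f ∘ suc) (λ r r′ → suc-injective (inj r r′))
... | yes p with f zero p
...   | j , q , r =
  -- A later element related to `j` would equal `zero`, so `j` can be taken out of `Q` before
  -- recursing.
  ≤-trans (s≤s (#-injection (P? ∘ suc) (Q? ─? j) (_~_ ∘ suc) f′ (λ r r′ → suc-injective (inj r r′))))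
          (#-─ Q? q)
  where
  f′ : ∀ i → _ → ∃ λ j′ → _ × suc i ~ j′
  f′ i p′ with f (suc i) p′
  ... | j′ , q′ , r′ = j′ , (q′ , λ { refl → case inj r r′ of λ () }) , r′

#-bounded : (P? : Decidable {A = Fin N} P) (g : Fin N → ℕ) (d : ℕ) → (∀ {i} → P i → g i < d) →
            (∀ {i j} → P i → P j → g i ≡ g j → i ≡ j) → # P? ≤ d
#-bounded {P = P} P? g d g< inj = ≤-trans
  (#-injection P? (λ (_ : Fin d) → yes tt) (λ i j → P i × g i ≡ toℕ j)
    (λ i p → fromℕ< (g< p) , tt , p , sym (toℕ-fromℕ< (g< p)))
    (λ (p , e) (p′ , e′) → inj p p′ (trans e (sym e′))))
  (≤-reflexive #-full)

module _ (P? : Decidable {A = Fin N} P) (g : Fin N → Fin k) where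

  Used : Fin k → Set
  Used c = ∃ λ i → P i × g i ≡ c

  used? : Decidable Used
  used? c = any? λ i → P? i ×-dec (g i ≟ c)

  #-unused : k ≤ # (¬? ∘ used?) + # P?
  #-unused = begin
    k                                  ≡⟨ #-full ⟨
    # {k} (λ _ → yes tt)               ≤⟨ #-⊎ _ (¬? ∘ used?) used? (λ {c} _ → split c) ⟩
    # (¬? ∘ used?) + # used?           ≤⟨ +-monoʳ-≤ _ (#-injection used? P? (λ c i → g i ≡ c)
                                            (λ c u → u) (λ e e′ → trans (sym e) e′)) ⟩
    # (¬? ∘ used?) + # P?              ∎
    where
    open ≤-Reasoning
    split : ∀ c → ¬ Used c ⊎ Used c
    split c with used? c
    ... | yes u = inj₂ u
    ... | no ¬u = inj₁ ¬u

  missing : # P? < k → ∃ λ c → ∀ {i} → P i → g i ≢ c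
  missing lt with any? (¬? ∘ used?)
  ... | yes (c , ¬u) = c , λ p e → ¬u (_ , p , e)
  ... | no none = contradiction (≤-trans #-unused (+-monoˡ-≤ _ none≤0)) (<⇒≱ lt)
    where
    none≤0 : # (¬? ∘ used?) ≤ 0
    none≤0 = #-bounded (¬? ∘ used?) (λ _ → 0) 0 (λ ¬u → ⊥-elim (none (_ , ¬u)))
                                               (λ ¬u → ⊥-elim (none (_ , ¬u)))

-- Extending and recombining colourings

Proper : {X : Set} → (Fin N → Fin N → Set) → (Fin N → Set) → (Fin N → X) → Set
Proper _~_ S g = ∀ {e f} → S e → S f → e ≢ f → e ~ f → g e ≢ g f

-- The values of `g′` are part of the conclusion because `twoColour` extends twice in a row and
-- `greedy` has to keep the precoloured values.
extend : {X : Set} (_~_ : Fin N → Fin N → Set) → Symmetric _~_ → {S : Fin N → Set} →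
         (e₀ : Fin N) (g : Fin N → X) (x : X) → Proper _~_ (S ─ e₀) g →
         (∀ {h} → (S ─ e₀) h → e₀ ~ h → g h ≢ x) →
         ∃ λ g′ → Proper _~_ S g′ × g′ e₀ ≡ x × (∀ {h} → h ≢ e₀ → g′ h ≡ g h)
extend {N} {X} _~_ ~-sym {S} e₀ g x proper avoid = g′ , proper′ , at , off
  where
  g′ : Fin N → X
  g′ e with e ≟ e₀
  ... | yes _ = x
  ... | no _  = g e
  at : g′ e₀ ≡ x
  at with e₀ ≟ e₀
  ... | yes _ = refl
  ... | no ne = ⊥-elim (ne refl)
  off : ∀ {h} → h ≢ e₀ → g′ h ≡ g h
  off {h} ne with h ≟ e₀
  ... | yes e = ⊥-elim (ne e)
  ... | no _  = refl
  proper′ : Proper _~_ S g′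
  proper′ {e} {f} se sf ne r with e ≟ e₀ | f ≟ e₀
  ... | yes refl | yes refl = ⊥-elim (ne refl)
  ... | yes refl | no f≢    = λ eq → avoid (sf , f≢) r (sym eq)
  ... | no e≢    | yes refl = avoid (se , e≢) (~-sym r)
  ... | no e≢    | no f≢    = proper (se , e≢) (sf , f≢) ne r

pigeonhole : {X : Set} {x y u v w : X} → u ≡ x ⊎ u ≡ y → v ≡ x ⊎ v ≡ y → w ≡ x ⊎ w ≡ y →
             u ≡ v ⊎ u ≡ w ⊎ v ≡ w
pigeonhole (inj₁ refl) (inj₁ refl) _           = inj₁ refl
pigeonhole (inj₂ refl) (inj₂ refl) _           = inj₁ refl
pigeonhole (inj₁ refl) (inj₂ refl) (inj₁ refl) = inj₂ (inj₁ refl)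
pigeonhole (inj₁ refl) (inj₂ refl) (inj₂ refl) = inj₂ (inj₂ refl)
pigeonhole (inj₂ refl) (inj₁ refl) (inj₂ refl) = inj₂ (inj₁ refl)
pigeonhole (inj₂ refl) (inj₁ refl) (inj₁ refl) = inj₂ (inj₂ refl)

-- Adjacency in a bipartite multigraph given by its two end maps. The sides are told apart by the
-- map, so `A` and `B` may be the same type.
SameEnd : {A B : Set} → (Fin N → A) → (Fin N → B) → Fin N → Fin N → Set
SameEnd a b e f = a e ≡ a f ⊎ b e ≡ b f

SameEnd-sym : {A B : Set} (a : Fin N → A) (b : Fin N → B) → Symmetric (SameEnd a b)
SameEnd-sym a b = Sum.map sym sym

-- Kőnig's edge-colouring theorem

-- Degree at most two at every value of `a`, put as a pigeonhole property so that it passes to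
-- subsets and to merged ends without counting.
AtMostTwo : {A : Set} → (Fin N → Set) → (Fin N → A) → Set
AtMostTwo S a = ∀ {e f h} → S e → S f → S h → a e ≡ a f → a e ≡ a h → e ≡ f ⊎ e ≡ h ⊎ f ≡ h

module Merge {B : Set} (_≟ᴮ_ : DecidableEquality B) (w₁ w₂ : B) where

  -- The quotient is realised inside `B`, with `w₁` as the representative, so the recursion in
  -- `twoColour` keeps its vertex type.
  merge : B → B
  merge v with v ≟ᴮ w₂
  ... | yes _ = w₁
  ... | no _  = v

  Merged : B → Set
  Merged v = v ≡ w₁ ⊎ v ≡ w₂

  merged : ∀ {v} → Merged v → merge v ≡ w₁
  merged {v} w with v ≟ᴮ w₂
  ... | yes _ = refl
  ... | no ne = [ id , (λ e → contradiction e ne) ]′ w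

  merge-inv : ∀ {u v} → merge u ≡ merge v → u ≡ v ⊎ Merged u × Merged v
  merge-inv {u} {v} eq with u ≟ᴮ w₂ | v ≟ᴮ w₂
  ... | yes refl | yes refl = inj₁ refl
  ... | yes refl | no _     = inj₂ (inj₂ refl , inj₁ (sym eq))
  ... | no _     | yes refl = inj₂ (inj₁ eq , inj₂ refl)
  ... | no _     | no _     = inj₁ eq

module _ {A B : Set} (_≟ᴬ_ : DecidableEquality A) (_≟ᴮ_ : DecidableEquality B) where

  -- Two edges e₁, e₂ sharing an end are deleted and their other ends are identified: in a colouring
  -- of the smaller graph the remaining edges at those other ends differ, so e₁ and e₂ fit in.
  twoColour : (a : Fin N → A) (b : Fin N → B) {S : Fin N → Set} (S? : Decidable S) → Acc _<_ (# S?) →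
              AtMostTwo S a → AtMostTwo S b → ∃ λ (g : Fin N → Bool) → Proper (SameEnd a b) S g
  twoColour a b {S} S? (acc rec) a≤2 b≤2 with any? S?
  ... | no none = (λ _ → true) , λ s → ⊥-elim (none (_ , s))
  ... | yes (e₁ , s₁) with any? (λ e → (S? ─? e₁) e ×-dec a e ≟ᴬ a e₁)
  ...   | no alone = let g , g-proper = twoColour a b (S? ─? e₁) (rec (#-─ S? s₁)) (a≤2′) b≤2′
                         x , x-avoids = colour g
                         g′ , g′-proper , _ = extend (SameEnd a b) (SameEnd-sym a b) e₁ g x g-proper x-avoids
                     in g′ , g′-proper
    where
    a≤2′ : AtMostTwo (S ─ e₁) a
    a≤2′ (s , _) (s′ , _) (s″ , _) = a≤2 s s′ s″
    b≤2′ : AtMostTwo (S ─ e₁) b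
    b≤2′ (s , _) (s′ , _) (s″ , _) = b≤2 s s′ s″
    -- As `e₁` is alone at its `a`-end, only the at most one other edge at its `b`-end restricts its
    -- colour.
    colour : (g : Fin _ → Bool) → ∃ λ x → ∀ {h} → (S ─ e₁) h → SameEnd a b e₁ h → g h ≢ x
    colour g with any? (λ f → (S? ─? e₁) f ×-dec b f ≟ᴮ b e₁)
    ... | no none = true , λ { s (inj₁ eq) → ⊥-elim (alone (_ , s , sym eq))
                             ; s (inj₂ eq) → ⊥-elim (none (_ , s , sym eq)) }
    ... | yes (f , (sf , f≢) , eq) = not (g f) , avoids
      where
      avoids : ∀ {h} → (S ─ e₁) h → SameEnd a b e₁ h → g h ≢ not (g f)
      avoids s (inj₁ eq′) = ⊥-elim (alone (_ , s , sym eq′))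
      avoids (s , h≢) (inj₂ eq′) with b≤2 s₁ sf s (sym eq) eq′
      ... | inj₁ e        = ⊥-elim (f≢ (sym e))
      ... | inj₂ (inj₁ e) = ⊥-elim (h≢ (sym e))
      ... | inj₂ (inj₂ refl) = not-¬ refl
  ...   | yes (e₂ , (s₂ , e₂≢e₁) , a₂₁) =
    let g , g-proper = twoColour a (merge ∘ b) S″? (rec (<-trans (#-─ (S? ─? e₁) (s₂ , e₂≢e₁)) (#-─ S? s₁)))
                                 a≤2″ b≤2″
        x , x-avoids , x̄-avoids = colour g g-proper
        g′ , g′-proper , g′e₂ , g′-off =
          extend (SameEnd a b) (SameEnd-sym a b) e₂ g x (λ s s′ ne → g-proper s s′ ne ∘ Sum.map₂ (cong merge))
            (λ { (s , ne) (inj₁ eq) → ⊥-elim (a-free (s , ne) (trans (sym eq) a₂₁))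
               ; s (inj₂ eq) → x-avoids s (sym eq) })
        g″ , g″-proper , _ = extend (SameEnd a b) (SameEnd-sym a b) e₁ g′ (not x) g′-proper
          (λ {h} s r → avoid₁ g g′ x g′e₂ g′-off x̄-avoids s r)
    in g″ , g″-proper
    where
    open Merge _≟ᴮ_ (b e₁) (b e₂)
    S″ = (S ─ e₁) ─ e₂
    S″? = (S? ─? e₁) ─? e₂
    a-free : ∀ {h} → S″ h → a h ≢ a e₁
    a-free ((s , h≢e₁) , h≢e₂) eq with a≤2 s₁ s₂ s (sym a₂₁) (sym eq)
    ... | inj₁ e        = e₂≢e₁ (sym e)
    ... | inj₂ (inj₁ e) = h≢e₁ (sym e)
    ... | inj₂ (inj₂ e) = h≢e₂ (sym e)
    unique : ∀ {e h h′} → e ≡ e₁ ⊎ e ≡ e₂ → S″ h → S″ h′ → b h ≡ b e → b h′ ≡ b e → h ≡ h′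
    unique (inj₁ refl) ((s , ne) , _) ((s′ , ne′) , _) eq eq′ with b≤2 s₁ s s′ (sym eq) (sym eq′)
    ... | inj₁ e        = ⊥-elim (ne (sym e))
    ... | inj₂ (inj₁ e) = ⊥-elim (ne′ (sym e))
    ... | inj₂ (inj₂ e) = e
    unique (inj₂ refl) ((s , _) , ne) ((s′ , _) , ne′) eq eq′ with b≤2 s₂ s s′ (sym eq) (sym eq′)
    ... | inj₁ e        = ⊥-elim (ne (sym e))
    ... | inj₂ (inj₁ e) = ⊥-elim (ne′ (sym e))
    ... | inj₂ (inj₂ e) = e
    unique′ : ∀ {h h′} → S″ h → S″ h′ → Merged (b h) → b h ≡ b h′ → h ≡ h′
    unique′ s s′ (inj₁ eq) eq′ = unique (inj₁ refl) s s′ eq (trans (sym eq′) eq)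
    unique′ s s′ (inj₂ eq) eq′ = unique (inj₂ refl) s s′ eq (trans (sym eq′) eq)
    a≤2″ : AtMostTwo S″ a
    a≤2″ ((s , _) , _) ((s′ , _) , _) ((s″ , _) , _) = a≤2 s s′ s″
    b≤2″ : AtMostTwo S″ (merge ∘ b)
    b≤2″ {e} {f} {h} s@((se , _) , _) s′@((sf , _) , _) s″@((sh , _) , _) eq eq′
      with merge-inv eq | merge-inv eq′
    ... | inj₁ q        | inj₁ q′        = b≤2 se sf sh q q′
    ... | inj₁ q        | inj₂ (w , _)   = inj₁ (unique′ s s′ w q)
    ... | inj₂ (w , _)  | inj₁ q′        = inj₂ (inj₁ (unique′ s s″ w q′))
    -- Of three edges at the merged vertex, two share an original end, and `unique′` allows only one
    -- remaining edge there.
    ... | inj₂ (w , w′) | inj₂ (_ , w″)  with pigeonhole w w′ w″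
    ...   | inj₁ q        = inj₁ (unique′ s s′ w q)
    ...   | inj₂ (inj₁ q) = inj₂ (inj₁ (unique′ s s″ w q))
    ...   | inj₂ (inj₂ q) = inj₂ (inj₂ (unique′ s′ s″ w′ q))
    -- Such an `h` would force `b e₁ ≡ b e₂`, giving three edges `e₁`, `e₂`, `h` at one vertex.
    loop-free : ∀ {h} → S″ h → b h ≡ b e₁ → b h ≢ b e₂
    loop-free ((s , h≢e₁) , h≢e₂) eq eq′ with b≤2 s₁ s₂ s (trans (sym eq) eq′) (sym eq)
    ... | inj₁ e        = e₂≢e₁ (sym e)
    ... | inj₂ (inj₁ e) = h≢e₁ (sym e)
    ... | inj₂ (inj₂ e) = h≢e₂ (sym e)
    -- The colour `x` is meant for `e₂` and `not x` for `e₁`. At most one remaining edge lies at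
    -- each of their `b`-ends; if both exist they meet at the merged vertex, so their colours differ
    -- and a single `x` serves both.
    colour : (g : Fin _ → Bool) → Proper (SameEnd a (merge ∘ b)) S″ g →
             ∃ λ x → (∀ {h} → S″ h → b h ≡ b e₂ → g h ≢ x) × (∀ {h} → S″ h → b h ≡ b e₁ → g h ≢ not x)
    colour g g-proper
      with any? (λ f → S″? f ×-dec b f ≟ᴮ b e₂) | any? (λ f → S″? f ×-dec b f ≟ᴮ b e₁)
    ... | yes (f , sf , bf) | _ =
      not (g f) ,
      (λ s eq → subst (λ h → g h ≢ not (g f)) (unique (inj₂ refl) sf s bf eq) (not-¬ refl)) ,
      (λ {h} s eq e → g-proper s sf (λ { refl → loop-free s eq bf })
         (inj₂ (trans (merged (inj₁ eq)) (sym (merged (inj₂ bf)))))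
         (trans e (not-involutive (g f))))
    ... | no none | yes (f , sf , bf) =
      g f , (λ s eq → ⊥-elim (none (_ , s , eq))) ,
      (λ s eq → subst (λ h → g h ≢ not (g f)) (unique (inj₁ refl) sf s bf eq) (not-¬ refl))
    ... | no none₂ | no none₁ =
      true , (λ s eq → ⊥-elim (none₂ (_ , s , eq))) , (λ s eq → ⊥-elim (none₁ (_ , s , eq)))
    avoid₁ : (g g′ : Fin _ → Bool) (x : Bool) → g′ e₂ ≡ x → (∀ {h} → h ≢ e₂ → g′ h ≡ g h) →
             (∀ {h} → S″ h → b h ≡ b e₁ → g h ≢ not x) →
             ∀ {h} → (S ─ e₁) h → SameEnd a b e₁ h → g′ h ≢ not x
    avoid₁ g g′ x at off avoids {h} s r with h ≟ e₂
    ... | yes refl = not-¬ at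
    ... | no ne with r
    ...   | inj₁ eq = ⊥-elim (a-free (s , ne) (sym eq))
    ...   | inj₂ eq = λ e → avoids (s , ne) (sym eq) (trans (sym (off ne)) e)

  -- Induction on the edges. A colour α is free for edge `zero` at its `a`-end and β at its `b`-end.
  -- If they differ, the edges coloured α or β together with `zero` have degree at most two
  -- everywhere, and `twoColour` recolours them with α and β. This takes the place of switching
  -- along an alternating path.
  konig : ∀ {N} d (a : Fin N → A) (b : Fin N → B) →
          (∀ v → # (λ e → a e ≟ᴬ v) ≤ d) → (∀ v → # (λ e → b e ≟ᴮ v) ≤ d) →
          ∃ λ (f : Fin N → Fin d) → ∀ {e e′} → e ≢ e′ → SameEnd a b e e′ → f e ≢ f e′
  konig {zero}  d a b a≤d b≤d = (λ ()) , λ { {()} }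
  konig {suc N} d a b a≤d b≤d = result
    where
    IH = konig d (a ∘ suc) (b ∘ suc) (λ v → ≤-trans (m≤n+m _ _) (a≤d v)) (λ v → ≤-trans (m≤n+m _ _) (b≤d v))
    f = proj₁ IH
    f-proper = proj₂ IH

    module Free {X : Set} (_≟ˣ_ : DecidableEquality X) (x : Fin (suc N) → X)
                (x≤d : ∀ v → # (λ e → x e ≟ˣ v) ≤ d)
                (proper : ∀ {e e′} → e ≢ e′ → x (suc e) ≡ x (suc e′) → f e ≢ f e′) where

      free : ∃ λ c → ∀ {e} → x (suc e) ≡ x zero → f e ≢ c
      free = missing (λ e → x (suc e) ≟ˣ x zero) f below
        where
        below : # (λ e → x (suc e) ≟ˣ x zero) < d
        -- Edge `zero` counts itself at its end, so fewer than `d` coloured edges lie there.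
        below with x zero ≟ˣ x zero | x≤d (x zero)
        ... | yes _ | le = le
        ... | no ne | _  = ⊥-elim (ne refl)

      -- The instances `U.c` and `W.c` agree except possibly on `zero`, and each is proper on its
      -- own side.
      c : Fin (suc N) → Fin d
      c zero    = proj₁ free
      c (suc e) = f e

      c-proper : ∀ {e e′} → e ≢ e′ → x e ≡ x e′ → c e ≢ c e′
      c-proper {zero}  {zero}   ne eq = ⊥-elim (ne refl)
      c-proper {zero}  {suc e′} ne eq = proj₂ free (sym eq) ∘ sym
      c-proper {suc e} {zero}   ne eq = proj₂ free eq
      c-proper {suc e} {suc e′} ne eq = proper (ne ∘ cong suc) eq

      c-inj : ∀ {e e′} → x e ≡ x e′ → c e ≡ c e′ → e ≡ e′
      c-inj {e} {e′} eq ceq with e ≟ e′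
      ... | yes q = q
      ... | no ne = ⊥-elim (c-proper ne eq ceq)

      atMostTwo : ∀ {α β} {S : Fin (suc N) → Set} → (∀ {e} → S e → c e ≡ α ⊎ c e ≡ β) → AtMostTwo S x
      atMostTwo mem s s′ s″ eq eq′ with pigeonhole (mem s) (mem s′) (mem s″)
      ... | inj₁ q        = inj₁ (c-inj eq q)
      ... | inj₂ (inj₁ q) = inj₂ (inj₁ (c-inj eq′ q))
      ... | inj₂ (inj₂ q) = inj₂ (inj₂ (c-inj (trans (sym eq) eq′) q))

    module U = Free _≟ᴬ_ a a≤d (λ ne → f-proper ne ∘ inj₁)
    module W = Free _≟ᴮ_ b b≤d (λ ne → f-proper ne ∘ inj₂)
    α = U.c zero
    β = W.c zero

    result : ∃ λ (g : Fin (suc N) → Fin d) → ∀ {e e′} → e ≢ e′ → SameEnd a b e e′ → g e ≢ g e′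
    result with α ≟ β
    ... | yes α≡β = U.c , λ ne → [ U.c-proper ne , W-proper ne ]′
      where
      same : ∀ e → U.c e ≡ W.c e
      same zero    = α≡β
      same (suc e) = refl
      W-proper : ∀ {e e′} → e ≢ e′ → b e ≡ b e′ → U.c e ≢ U.c e′
      W-proper {e} {e′} ne eq q = W.c-proper ne eq (trans (sym (same e)) (trans q (same e′)))
    ... | no α≢β = g , g-proper
      where
      S : Fin (suc N) → Set
      S e = U.c e ≡ α ⊎ U.c e ≡ β
      S? : Decidable S
      S? e = (U.c e ≟ α) ⊎-dec (U.c e ≟ β)
      SW : ∀ {e} → S e → W.c e ≡ α ⊎ W.c e ≡ β
      SW {zero}  _ = inj₂ refl
      SW {suc e} s = s
      two = twoColour a b S? (<-wellFounded _) (U.atMostTwo {S = S} id) (W.atMostTwo (λ {e} → SW {e}))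
      pick : Bool → Fin d
      pick t = if t then α else β
      pick-inj : ∀ {s t} → pick s ≡ pick t → s ≡ t
      pick-inj {false} {false} _  = refl
      pick-inj {false} {true}  eq = ⊥-elim (α≢β (sym eq))
      pick-inj {true}  {false} eq = ⊥-elim (α≢β eq)
      pick-inj {true}  {true}  _  = refl
      pick∈ : ∀ t → pick t ≡ α ⊎ pick t ≡ β
      pick∈ true  = inj₁ refl
      pick∈ false = inj₂ refl
      g : Fin (suc N) → Fin d
      g e with S? e
      ... | yes _ = pick (proj₁ two e)
      ... | no _  = U.c e
      mixed : ∀ {e t} → ¬ S e → pick t ≢ U.c e
      mixed {t = t} ¬s eq = ¬s (Sum.map (trans (sym eq)) (trans (sym eq)) (pick∈ t))
      proper′ : ∀ {e e′} → ¬ S e → ¬ S e′ → e ≢ e′ → SameEnd a b e e′ → U.c e ≢ U.c e′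
      proper′ ¬s ¬s′ ne (inj₁ eq) = U.c-proper ne eq
      -- Edge `zero` has colour α under `U.c` and so lies in `S`; on all other edges `U.c` and `W.c`
      -- coincide.
      proper′ {zero}  ¬s _ _ _ = ⊥-elim (¬s (inj₁ refl))
      proper′ {suc e} {zero} _ ¬s _ _ = ⊥-elim (¬s (inj₁ refl))
      proper′ {suc e} {suc e′} ¬s ¬s′ ne (inj₂ eq) = W.c-proper ne eq
      g-proper : ∀ {e e′} → e ≢ e′ → SameEnd a b e e′ → g e ≢ g e′
      g-proper {e} {e′} ne r with S? e | S? e′
      ... | yes s | yes s′ = proj₂ two s s′ ne r ∘ pick-inj
      ... | yes _ | no ¬s′ = mixed {e′} ¬s′
      ... | no ¬s | yes _  = mixed {e} ¬s ∘ sym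
      ... | no ¬s | no ¬s′ = proper′ {e} {e′} ¬s ¬s′ ne r

-- Galvin's theorem

module Galvin {A B : Set} (_≟ᴬ_ : DecidableEquality A) (_≟ᴮ_ : DecidableEquality B)
              (a : Fin N → A) (b : Fin N → B) (p q : Fin N → ℕ)
              (p-inj : ∀ {e f} → a e ≡ a f → p e ≡ p f → e ≡ f)
              (q-inj : ∀ {e f} → b e ≡ b f → q e ≡ q f → e ≡ f) where

  Betterᵃ Betterᵇ : (Fin N → Set) → Fin N → Fin N → Set
  Betterᵃ S e f = S f × a f ≡ a e × p f < p e
  Betterᵇ S e f = S f × b f ≡ b e × q f < q e

  betterᵃ? : {S : Fin N → Set} → Decidable S → ∀ e → Decidable (Betterᵃ S e)
  betterᵃ? S? e f = S? f ×-dec a f ≟ᴬ a e ×-dec p f <? p e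

  betterᵇ? : {S : Fin N → Set} → Decidable S → ∀ e → Decidable (Betterᵇ S e)
  betterᵇ? S? e f = S? f ×-dec b f ≟ᴮ b e ×-dec q f <? q e

  -- A stable matching in `S`: each edge left out is beaten at one of its ends by an edge of `T`.
  -- Smaller ranks are preferred.
  record Kernel (S : Fin N → Set) : Set₁ where
    field
      T           : Fin N → Set
      T?          : Decidable T
      T⊆S         : ∀ {e} → T e → S e
      independent : ∀ {e f} → T e → T f → SameEnd a b e f → e ≡ f
      absorbing   : ∀ {e} → S e → T e ⊎ ∃ (λ f → Betterᵃ T e f ⊎ Betterᵇ T e f)

  -- If f is p-best at its a-end and q-better than e, then a kernel of S ─ e absorbs e as well:
  -- it contains f or an edge that is q-better than f.
  kernel : {S : Fin N → Set} (S? : Decidable S) → Acc _<_ (# S?) → Kernel S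
  kernel {S} S? (acc rec) = result
    where
    Best : Fin N → Set
    Best e = S e × ¬ ∃ (Betterᵃ S e)
    best? : Decidable Best
    best? e = S? e ×-dec ¬? (any? (betterᵃ? S? e))

    best-inj : ∀ {e f} → Best e → Best f → a e ≡ a f → e ≡ f
    best-inj {e} {f} (s , be) (s′ , bf) eq with <-cmp (p e) (p f)
    ... | tri< lt _ _ = ⊥-elim (bf (_ , s , eq , lt))
    ... | tri≈ _ p≡ _ = p-inj eq p≡
    ... | tri> _ _ gt = ⊥-elim (be (_ , s′ , sym eq , gt))

    best : ∀ e → S e → Acc _<_ (p e) → Best e ⊎ ∃ (Betterᵃ Best e)
    best e s (acc rec) with any? (betterᵃ? S? e)
    ... | no none = inj₁ (s , none)
    ... | yes (f , sf , eq , lt) with best f sf (rec lt)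
    ...   | inj₁ bf                  = inj₂ (f , bf , eq , lt)
    ...   | inj₂ (g , bg , eq′ , lt′) = inj₂ (g , bg , trans eq′ eq , <-trans lt′ lt)

    result : Kernel S
    result with any? (λ e → S? e ×-dec any? (betterᵇ? best? e))
    -- Here no edge of `S` is beaten at its `b`-end by a best edge. The best edges, one per occupied
    -- `a`-end, then also differ at their `b`-ends and form a kernel.
    ... | no none = record
      { T = Best ; T? = best? ; T⊆S = proj₁
      ; independent = λ { be bf (inj₁ eq) → best-inj be bf eq ; be bf (inj₂ eq) → independent be bf eq }
      ; absorbing = λ s → Sum.map₂ (λ (f , bf) → f , inj₁ bf) (best _ s (<-wellFounded _)) }
      where
      independent : ∀ {e f} → Best e → Best f → b e ≡ b f → e ≡ f
      independent {e} {f} be bf eq with <-cmp (q e) (q f)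
      ... | tri< lt _ _ = ⊥-elim (none (f , proj₁ bf , e , be , eq , lt))
      ... | tri≈ _ q≡ _ = q-inj eq q≡
      ... | tri> _ _ gt = ⊥-elim (none (e , proj₁ be , f , bf , sym eq , gt))
    ... | yes (e , s , f , bf@(sf , best-f) , eq , lt) = record
      { T = K.T ; T? = K.T? ; T⊆S = proj₁ ∘ K.T⊆S ; independent = K.independent ; absorbing = absorbing }
      where
      module K = Kernel (kernel (S? ─? e) (rec (#-─ S? s)))
      absorbing : ∀ {h} → S h → K.T h ⊎ ∃ (λ g → Betterᵃ K.T h g ⊎ Betterᵇ K.T h g)
      absorbing {h} sh with h ≟ e
      ... | no h≢e = K.absorbing (sh , h≢e)
      ... | yes refl with K.absorbing {f} (sf , λ { refl → <-irrefl refl lt })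
      ...   | inj₁ tf                             = inj₂ (f , inj₂ (tf , eq , lt))
      -- Nothing in `S` is p-better than `f`, so `f` can be absorbed only at its `b`-end, which it
      -- shares with `e`.
      ...   | inj₂ (g , inj₁ (tg , eq′ , lt′))    = ⊥-elim (best-f (g , proj₁ (K.T⊆S tg) , eq′ , lt′))
      ...   | inj₂ (g , inj₂ (tg , eq′ , lt′))    = inj₂ (g , inj₂ (tg , trans eq′ eq , <-trans lt′ lt))

  -- Induction on the palette: colour `zero` goes to a kernel of the edges that list it. Any other
  -- such edge loses one colour from its list, but also a better edge, so the strict inequality
  -- survives. The colouring takes a proof of `S e`, since an empty palette offers no default
  -- colour.
  listColouring : ∀ k {S : Fin N → Set} (S? : Decidable S) {L : Fin N → Fin k → Set} (L? : ∀ e → Decidable (L e)) →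
                  (∀ {e} → S e → # (betterᵃ? S? e) + # (betterᵇ? S? e) < # (L? e)) →
                  ∃ λ (c : ∀ e → S e → Fin k) → (∀ {e} (s : S e) → L e (c e s)) ×
                    (∀ {e f} (s : S e) (s′ : S f) → e ≢ f → SameEnd a b e f → c e s ≢ c f s′)
  listColouring zero S? L? short = (λ e s → ⊥-elim (none s)) , (λ s → ⊥-elim (none s)) , λ s → ⊥-elim (none s)
    where
    none : ∀ {e} → ¬ _
    none {e} s with short {e} s
    ... | ()
  listColouring (suc k) {S} S? {L} L? short = c , c∈L , c-proper
    where
    S₀? : Decidable (λ e → S e × L e zero)
    S₀? e = S? e ×-dec L? e zero
    open Kernel (kernel S₀? (<-wellFounded _))
    S′? : Decidable (λ e → S e × ¬ T e)
    S′? e = S? e ×-dec ¬? (T? e)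
    ≤ᵃ : ∀ e → # (betterᵃ? S′? e) ≤ # (betterᵃ? S? e)
    ≤ᵃ e = #-mono (betterᵃ? S′? e) (betterᵃ? S? e) (λ ((s , _) , r) → s , r)
    ≤ᵇ : ∀ e → # (betterᵇ? S′? e) ≤ # (betterᵇ? S? e)
    ≤ᵇ e = #-mono (betterᵇ? S′? e) (betterᵇ? S? e) (λ ((s , _) , r) → s , r)
    drop : ∀ {e} → S e × ¬ T e → L e zero →
           # (betterᵃ? S′? e) + # (betterᵇ? S′? e) < # (betterᵃ? S? e) + # (betterᵇ? S? e)
    drop {e} (s , ¬t) l with absorbing (s , l)
    ... | inj₁ t = ⊥-elim (¬t t)
    ... | inj₂ (f , inj₁ (t , r)) =
      +-mono-<-≤ (#-strict (betterᵃ? S′? e) (betterᵃ? S? e) (λ ((s , _) , r) → s , r)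
                           (proj₁ (T⊆S t) , r) (λ ((_ , ¬t) , _) → ¬t t)) (≤ᵇ e)
    ... | inj₂ (f , inj₂ (t , r)) =
      +-mono-≤-< (≤ᵃ e) (#-strict (betterᵇ? S′? e) (betterᵇ? S? e) (λ ((s , _) , r) → s , r)
                           (proj₁ (T⊆S t) , r) (λ ((_ , ¬t) , _) → ¬t t))
    short′ : ∀ {e} → S e × ¬ T e → # (betterᵃ? S′? e) + # (betterᵇ? S′? e) < # (L? e ∘ suc)
    short′ {e} s with L? e zero | short (proj₁ s)
    ... | yes l | lt = <-≤-trans (drop s l) (s≤s⁻¹ lt)
    ... | no _  | lt = ≤-<-trans (+-mono-≤ (≤ᵃ e) (≤ᵇ e)) lt
    rest = listColouring k S′? (λ e → L? e ∘ suc) short′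
    c : ∀ e → S e → Fin (suc k)
    c e s with T? e
    ... | yes _ = zero
    ... | no ¬t = suc (proj₁ rest e (s , ¬t))
    c∈L : ∀ {e} (s : S e) → L e (c e s)
    c∈L {e} s with T? e
    ... | yes t = proj₂ (T⊆S t)
    ... | no ¬t = proj₁ (proj₂ rest) (s , ¬t)
    c-proper : ∀ {e f} (s : S e) (s′ : S f) → e ≢ f → SameEnd a b e f → c e s ≢ c f s′
    c-proper {e} {f} s s′ ne r with T? e | T? f
    ... | yes t | yes t′ = ⊥-elim (ne (independent t t′ r))
    ... | yes _ | no _   = λ ()
    ... | no _  | yes _  = λ ()
    ... | no ¬t | no ¬t′ = proj₂ (proj₂ rest) (s , ¬t) (s′ , ¬t′) ne r ∘ suc-injective

-- Rankings with main and extra edges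

split : (P? : Decidable {A = Fin N} P) (d y : ℕ) → # P? ≤ d + y →
        ∃ λ (t : Fin N → Bool) → # (λ e → P? e ×-dec t e Bool.≟ true) ≤ d ×
                                 # (λ e → P? e ×-dec t e Bool.≟ false) ≤ y
split {zero}  P? d y le = (λ ()) , z≤n , z≤n
split {suc N} {P} P? d y le = helper (P? zero) d y le
  where
  Split : (t : Fin (suc N) → Bool) → Dec (P zero) → ℕ → ℕ → Set
  Split t p d y = ind (p ×-dec t zero Bool.≟ true) + # (λ e → P? (suc e) ×-dec t (suc e) Bool.≟ true) ≤ d ×
                  ind (p ×-dec t zero Bool.≟ false) + # (λ e → P? (suc e) ×-dec t (suc e) Bool.≟ false) ≤ y
  helper : ∀ p d y → ind p + # (P? ∘ suc) ≤ d + y → ∃ λ t → Split t p d y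
  helper (no ¬p) d y le = let t , t₁ , t₀ = split (P? ∘ suc) d y le in true ∷ t , t₁ , t₀
  helper (yes p) (suc d) y (s≤s le) = let t , t₁ , t₀ = split (P? ∘ suc) d y le in true ∷ t , s≤s t₁ , t₀
  helper (yes p) zero (suc y) (s≤s le) = let t , t₁ , t₀ = split (P? ∘ suc) 0 y le in false ∷ t , t₁ , s≤s t₀

-- At every vertex v at most d + 1 edges of C are main, the at most y v others are extra. Non-main edges
-- get a private end, so that d + 1 colours suffice for the new ends. Extra edges
-- precede main ones in the ranking, and main edges are ranked by their colour.
module Ranking {V : Set} (_≟ⱽ_ : DecidableEquality V) {C : Fin N → Set} (C? : Decidable C) (a : Fin N → V)
               (d : ℕ) (y : V → ℕ) (bound : ∀ v → # (λ e → C? e ×-dec a e ≟ⱽ v) ≤ suc d + y v) where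

  _≟ⱽᴺ_ : DecidableEquality (V ⊎ Fin N)
  _≟ⱽᴺ_ = ≡-dec _≟ⱽ_ _≟_

  t : V → Fin N → Bool
  t v = proj₁ (split (λ e → C? e ×-dec a e ≟ⱽ v) (suc d) (y v) (bound v))

  Main : Fin N → Set
  Main e = C e × t (a e) e ≡ true

  main? : Decidable Main
  main? e = C? e ×-dec t (a e) e Bool.≟ true

  end : Fin N → V ⊎ Fin N
  end e with main? e
  ... | yes _ = inj₁ (a e)
  ... | no _  = inj₂ e

  end-main : ∀ {e} → Main e → end e ≡ inj₁ (a e)
  end-main {e} me with main? e
  ... | yes _  = refl
  ... | no ¬me = ⊥-elim (¬me me)

  end-inj₁ : ∀ {e v} → end e ≡ inj₁ v → Main e × a e ≡ v
  end-inj₁ {e} eq with main? e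
  end-inj₁ refl | yes me = me , refl

  end-inj₂ : ∀ {e f} → end e ≡ inj₂ f → e ≡ f
  end-inj₂ {e} eq with main? e
  end-inj₂ refl | no _ = refl

  end-degree : ∀ v → # (λ e → end e ≟ⱽᴺ v) ≤ suc d
  end-degree (inj₁ v) = ≤-trans (#-mono (λ e → end e ≟ⱽᴺ inj₁ v) _ to)
                                (proj₁ (proj₂ (split (λ e → C? e ×-dec a e ≟ⱽ v) (suc d) (y v) (bound v))))
    where
    to : ∀ {e} → end e ≡ inj₁ v → (C e × a e ≡ v) × t v e ≡ true
    to eq with end-inj₁ eq
    ... | (ce , te) , refl = (ce , refl) , te
  -- A private end carries a single edge, which is within the bound because `suc d` is positive.
  end-degree (inj₂ f) = #-bounded (λ e → end e ≟ⱽᴺ inj₂ f) (λ _ → 0) (suc d) (λ _ → z<s)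
                                  (λ eq eq′ _ → trans (end-inj₂ eq) (sym (end-inj₂ eq′)))

  module _ {D : ℕ} (g : Fin N → Fin D) (g-proper : ∀ {e f} → e ≢ f → end e ≡ end f → g e ≢ g f) where

    rank : Fin N → ℕ
    rank e with main? e
    -- The offset `N` exceeds every index `toℕ e`, the rank of a non-main edge.
    ... | yes _ = N + toℕ (g e)
    ... | no _  = toℕ e

    g-inj : ∀ {e f} → Main e → Main f → a e ≡ a f → g e ≡ g f → e ≡ f
    g-inj {e} {f} me mf eq geq with e ≟ f
    ... | yes e≡f = e≡f
    ... | no ne   = ⊥-elim (g-proper ne (trans (end-main me) (trans (cong inj₁ eq) (sym (end-main mf)))) geq)

    rank-inj : ∀ {e f} → a e ≡ a f → rank e ≡ rank f → e ≡ f
    rank-inj {e} {f} eq req with main? e | main? f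
    ... | yes me | yes mf = g-inj me mf eq (toℕ-injective (+-cancelˡ-≡ N _ _ req))
    ... | yes _  | no _   = ⊥-elim (<⇒≱ (toℕ<n f) (≤-trans (m≤m+n N _) (≤-reflexive req)))
    ... | no _   | yes _  = ⊥-elim (<⇒≱ (toℕ<n e) (≤-trans (m≤m+n N _) (≤-reflexive (sym req))))
    ... | no _   | no _   = toℕ-injective req

    better? : ∀ e → Decidable (λ f → C f × a f ≡ a e × rank f < rank e)
    better? e f = C? f ×-dec a f ≟ⱽ a e ×-dec rank f <? rank e

    -- A better edge is either extra, of which there are at most `y (a e)`, or main with a colour
    -- below that of `e`; main edges at a common end have distinct colours.
    rank-bound : ∀ e → # (better? e) ≤ y (a e) + toℕ (g e)
    rank-bound e = ≤-trans (#-⊎ (better? e) extra? lower? classify)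
      (+-mono-≤ (proj₂ (proj₂ (split (λ f → C? f ×-dec a f ≟ⱽ a e) (suc d) (y (a e)) (bound (a e)))))
                (#-bounded lower? (toℕ ∘ g) (toℕ (g e)) (proj₂ ∘ proj₂)
                  (λ (mf , eq , _) (mh , eq′ , _) → g-inj mf mh (trans eq (sym eq′)) ∘ toℕ-injective)))
      where
      extra? : Decidable (λ f → (C f × a f ≡ a e) × t (a e) f ≡ false)
      extra? f = (C? f ×-dec a f ≟ⱽ a e) ×-dec t (a e) f Bool.≟ false
      lower? : Decidable (λ f → Main f × a f ≡ a e × toℕ (g f) < toℕ (g e))
      lower? f = main? f ×-dec a f ≟ⱽ a e ×-dec toℕ (g f) <? toℕ (g e)
      classify : ∀ {f} → C f × a f ≡ a e × rank f < rank e →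
                 (C f × a f ≡ a e) × t (a e) f ≡ false ⊎ Main f × a f ≡ a e × toℕ (g f) < toℕ (g e)
      classify {f} (cf , eq , lt) with main? f | main? e
      ... | yes mf | yes _ = inj₂ (mf , eq , +-cancelˡ-< N _ _ lt)
      ... | yes mf | no _  = ⊥-elim (<-asym lt (<-≤-trans (toℕ<n e) (m≤m+n N _)))
      ... | no ¬mf | _     = inj₁ ((cf , eq) , ¬-not (λ te → ¬mf (cf , subst (λ v → t v f ≡ true) (sym eq) te)))

-- Assembling the colouring

-- Edges outside `F` are taken out of `S` until only precoloured ones remain. Each is then put back
-- while fewer than `k` edges of `S` meet it, so a colour is free.
greedy : {_~_ : Fin N → Fin N → Set} → Symmetric _~_ → (~? : ∀ e → Decidable (e ~_)) →
         {S F : Fin N → Set} (S? : Decidable S) (F? : Decidable F) (pre : Fin N → Fin k) → Proper _~_ F pre →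
         (∀ {e} → S e → ¬ F e → # (λ f → (S? ─? e) f ×-dec ~? e f) < k) →
         Acc _<_ (# (λ e → S? e ×-dec ¬? (F? e))) →
         ∃ λ (c : Fin N → Fin k) → Proper _~_ S c × (∀ {e} → F e → c e ≡ pre e)
greedy {_~_ = _~_} ~-sym ~? {S} {F} S? F? pre pre-proper few (acc rec) with any? (λ e → S? e ×-dec ¬? (F? e))
... | no none = pre , (λ s s′ → pre-proper (S⊆F s) (S⊆F s′)) , λ _ → refl
  where
  S⊆F : ∀ {e} → S e → F e
  S⊆F {e} s with F? e
  ... | yes f = f
  ... | no ¬f = ⊥-elim (none (e , s , ¬f))
... | yes (e , s , ¬f) =
  let c , c-proper , c-pre = greedy ~-sym ~? (S? ─? e) F? pre pre-proper few′ (rec smaller)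
      x , x-free = missing (λ f → (S? ─? e) f ×-dec ~? e f) c (few s ¬f)
      c′ , c′-proper , _ , c′-off = extend _~_ ~-sym e c x c-proper (λ s′ r → x-free (s′ , r))
  in c′ , c′-proper , λ f → trans (c′-off λ { refl → ¬f f }) (c-pre f)
  where
  few′ : ∀ {e′} → (S ─ e) e′ → ¬ F e′ → # (λ f → ((S? ─? e) ─? e′) f ×-dec ~? e′ f) < _
  few′ {e′} (s′ , _) ¬f′ = ≤-<-trans
    (#-mono (λ f → ((S? ─? e) ─? e′) f ×-dec ~? e′ f) (λ f → (S? ─? e′) f ×-dec ~? e′ f)
            (λ (((s″ , _) , ne) , r) → (s″ , ne) , r))
    (few s′ ¬f′)
  smaller : # (λ h → (S? ─? e) h ×-dec ¬? (F? h)) < # (λ h → S? h ×-dec ¬? (F? h))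
  smaller = #-strict (λ h → (S? ─? e) h ×-dec ¬? (F? h)) (λ h → S? h ×-dec ¬? (F? h))
                     (λ ((s′ , _) , ¬f′) → s′ , ¬f′) (s , ¬f) (λ ((_ , ne) , _) → ne refl)

-- Degrees and adjacency in a multigraph

length-filter-tabulate : {A : Set} {P : A → Set} (P? : Decidable P) (f : Fin N → A) →
                         length (filter P? (tabulate f)) ≡ # (P? ∘ f)
length-filter-tabulate {zero}  P? f = refl
length-filter-tabulate {suc N} P? f with P? (f zero)
... | yes _ = cong suc (length-filter-tabulate P? (f ∘ suc))
... | no _  = length-filter-tabulate P? (f ∘ suc)

module _ (G : Multigraph) where

  private
    V = Fin (n G)
    E = Fin (m G)

  degree≡# : ∀ v → degree G v ≡ # (λ e → incident? G e v)
  degree≡# v = length-filter-tabulate (λ e → incident? G e v) id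

  degree≤maxDegree : ∀ v → degree G v ≤ maxDegree G
  degree≤maxDegree v = foldr-preservesᵒ {P = degree G v ≤_} (λ x y → [ m≤n⇒m≤n⊔o y , m≤n⇒m≤o⊔n x ]′) 0 _
                         (inj₂ (lose (∈-map⁺ (degree G) (∈-allFin v)) ≤-refl))

  Adjacent-sym : Symmetric (Adjacent G)
  Adjacent-sym (inj₁ (inj₁ eq)) = inj₁ (inj₁ (sym eq))
  Adjacent-sym (inj₁ (inj₂ eq)) = inj₂ (inj₁ (sym eq))
  Adjacent-sym (inj₂ (inj₁ eq)) = inj₁ (inj₂ (sym eq))
  Adjacent-sym (inj₂ (inj₂ eq)) = inj₂ (inj₂ (sym eq))

  adjacent? : ∀ e → Decidable (Adjacent G e)
  adjacent? e f = incident? G f (proj₁ (ends G e)) ⊎-dec incident? G f (proj₂ (ends G e))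

  Incident² : ∀ {e f v} → Incident G e v → Incident G f v → Adjacent G e f
  Incident² (inj₁ refl) i = inj₁ i
  Incident² (inj₂ refl) i = inj₂ i

  Adjacent⇒Incident² : ∀ {e f} → Adjacent G e f → ∃ λ v → Incident G e v × Incident G f v
  Adjacent⇒Incident² (inj₁ i) = _ , inj₁ refl , i
  Adjacent⇒Incident² (inj₂ i) = _ , inj₂ refl , i

  maxDegree≤1⇒nonadjacent : maxDegree G ≤ 1 → ∀ {e f} → e ≢ f → ¬ Adjacent G e f
  maxDegree≤1⇒nonadjacent Δ≤1 {e} {f} ne r with Adjacent⇒Incident² r
  ... | v , i , i′ = <⇒≱ two (≤-trans (degree≤maxDegree v) Δ≤1)
    where
    inc? : Decidable (λ h → Incident G h v)
    inc? h = incident? G h v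
    two : 1 < degree G v
    two = ≤-trans (≤-<-trans (#-positive (inc? ─? e) (i′ , ne ∘ sym)) (#-─ inc? i)) (≤-reflexive (sym (degree≡# v)))

  -- Locally maximal cuts

  Cross : (V → Bool) → E → Set
  Cross σ e = σ (proj₁ (ends G e)) ≢ σ (proj₂ (ends G e))

  cross? : ∀ σ → Decidable (Cross σ)
  cross? σ e = ¬? (σ (proj₁ (ends G e)) Bool.≟ σ (proj₂ (ends G e)))

  module _ {F : E → Set} (F? : Decidable F) where

    cut? : ∀ σ → Decidable (λ e → F e × Cross σ e)
    cut? σ e = F? e ×-dec cross? σ e

    inner? : ∀ σ → Decidable (λ e → F e × ¬ Cross σ e)
    inner? σ e = F? e ×-dec ¬? (cross? σ e)

    cutDegree innerDegree : (V → Bool) → V → ℕ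
    cutDegree σ v = # (λ e → cut? σ e ×-dec incident? G e v)
    innerDegree σ v = # (λ e → inner? σ e ×-dec incident? G e v)

    flip : (V → Bool) → V → V → Bool
    flip σ v w with w ≟ v
    ... | yes _ = not (σ w)
    ... | no _  = σ w

    flip-cross : ∀ σ v {e} → Cross σ e → ¬ Incident G e v → Cross (flip σ v) e
    flip-cross σ v {e} c ¬i with proj₁ (ends G e) ≟ v | proj₂ (ends G e) ≟ v
    ... | yes eq | _      = ⊥-elim (¬i (inj₁ eq))
    ... | no _   | yes eq = ⊥-elim (¬i (inj₂ eq))
    ... | no _   | no _   = c

    flip-inner : ∀ σ v {e} → ¬ Cross σ e → Incident G e v → Cross (flip σ v) e
    flip-inner σ v {e} ¬c i with proj₁ (ends G e) ≟ v | proj₂ (ends G e) ≟ v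
    ... | yes eq | yes eq′ = ⊥-elim (loopless G e (trans eq (sym eq′)))
    ... | yes _  | no _    = λ eq → ¬c λ eq′ → not-¬ (sym eq′) (sym eq)
    ... | no _   | yes _   = λ eq → ¬c λ eq′ → not-¬ eq′ eq
    ... | no ¬e  | no ¬e′  = ⊥-elim ([ ¬e , ¬e′ ]′ i)

    -- Switching `v` makes the inner edges at `v` cross, there being no loops, and leaves the
    -- crossing edges away from `v` in the cut.
    flip-improves : ∀ σ v → cutDegree σ v < innerDegree σ v → # (cut? σ) < # (cut? (flip σ v))
    flip-improves σ v lt = begin-strict
      # (cut? σ)                            ≤⟨ #-⊎ (cut? σ) at? off? split′ ⟩
      cutDegree σ v + # off?                <⟨ +-monoˡ-< (# off?) lt ⟩
      innerDegree σ v + # off?              ≤⟨ #-disjoint _ off? (cut? (flip σ v)) (λ (_ , i) (_ , ¬i) → ¬i i)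
                                                [ (λ ((f , ¬c) , i) → f , flip-inner σ v ¬c i)
                                                , (λ ((f , c) , ¬i) → f , flip-cross σ v c ¬i) ]′ ⟩
      # (cut? (flip σ v))                   ∎
      where
      open ≤-Reasoning
      at? : Decidable (λ e → (F e × Cross σ e) × Incident G e v)
      at? e = cut? σ e ×-dec incident? G e v
      off? : Decidable (λ e → (F e × Cross σ e) × ¬ Incident G e v)
      off? e = cut? σ e ×-dec ¬? (incident? G e v)
      split′ : ∀ {e} → F e × Cross σ e → _
      split′ {e} c with incident? G e v
      ... | yes i = inj₁ (c , i)
      ... | no ¬i = inj₂ (c , ¬i)

    -- Local search: each switch enlarges the cut, so fuel plus cut size stays at least `m G`. With
    -- no fuel left, one more switch would give a cut of more than `m G` edges.
    maxCut : ∃ λ σ → ∀ v → innerDegree σ v ≤ cutDegree σ v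
    maxCut = improve (m G) (λ _ → true) (m≤m+n _ _)
      where
      improve : ∀ fuel σ → m G ≤ fuel + # (cut? σ) → ∃ λ σ → ∀ v → innerDegree σ v ≤ cutDegree σ v
      improve fuel σ le with all? (λ v → innerDegree σ v ≤? cutDegree σ v)
      ... | yes good = σ , good
      ... | no bad with ¬∀⟶∃¬ (n G) _ (λ v → innerDegree σ v ≤? cutDegree σ v) bad
      ...   | v , ¬le with fuel
      ...     | zero = ⊥-elim (<⇒≱ (≤-<-trans le (flip-improves σ v (≰⇒> ¬le))) (#-≤N (cut? (flip σ v))))
      ...     | suc fuel = improve fuel (flip σ v)
                (≤-trans le (≤-trans (≤-reflexive (sym (+-suc fuel _))) (+-monoʳ-≤ fuel (flip-improves σ v (≰⇒> ¬le)))))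

  -- Extending a coloured matching

  -- Here `suc d` is the D of the outline, written as a successor because D is positive and the
  -- largest colour index below D is then `d`.
  extendPrecolouring : ∀ {K} d X → (∀ v → degree G v ≤ suc d + X) → suc d ≤ X → suc d + (X + X) ≤ K →
    (M : EdgeSet G) → IsMatching G M → (pre : E → Fin K) →
    ∃ λ (c : EdgeColouring G K) → IsProper G c × (∀ e → M e ≡ true → c e ≡ pre e)
  extendPrecolouring {K} d X deg≤ d<X K≥ M matching pre = c , c-proper , c-pre
    where
    M? : Decidable (λ e → M e ≡ true)
    M? e = M e Bool.≟ true
    F? : Decidable (λ e → M e ≢ true)
    F? e = ¬? (M? e)
    σ = proj₁ (maxCut F?)
    C : E → Set
    C e = M e ≢ true × Cross σ e
    C? : Decidable C
    C? = cut? F? σ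

    x y : V → ℕ
    x v = # (λ e → ¬? (C? e) ×-dec incident? G e v)
    y v = X ∸ x v

    degree-split : ∀ v → x v + cutDegree F? σ v ≤ suc d + X
    degree-split v = ≤-trans
      (#-disjoint (λ e → ¬? (C? e) ×-dec incident? G e v) (λ e → C? e ×-dec incident? G e v) (λ e → incident? G e v)
        (λ (¬c , _) (c , _) → ¬c c) [ proj₂ , proj₂ ]′)
      (≤-trans (≤-reflexive (sym (degree≡# v))) (deg≤ v))

    -- The matching has at most one edge at `v`; all else counted by `x v` is inner, and the cut was
    -- chosen so that inner edges do not outnumber crossing ones.
    x≤1+cut : ∀ v → x v ≤ 1 + cutDegree F? σ v
    x≤1+cut v = ≤-trans
      (#-⊎ (λ e → ¬? (C? e) ×-dec incident? G e v) matched? (λ e → inner? F? σ e ×-dec incident? G e v) classify)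
      (+-mono-≤ (#-bounded matched? (λ _ → 0) 1 (λ _ → z<s) (λ mi mi′ _ → matched-unique mi mi′)) (proj₂ (maxCut F?) v))
      where
      matched? : Decidable (λ e → M e ≡ true × Incident G e v)
      matched? e = M? e ×-dec incident? G e v
      matched-unique : ∀ {e f} → M e ≡ true × Incident G e v → M f ≡ true × Incident G f v → e ≡ f
      matched-unique {e} {f} (me , i) (mf , i′) with e ≟ f
      ... | yes eq = eq
      ... | no ne  = ⊥-elim (matching e f me mf ne (Incident² i i′))
      classify : ∀ {e} → ¬ C e × Incident G e v →
                 (M e ≡ true × Incident G e v) ⊎ ((M e ≢ true × ¬ Cross σ e) × Incident G e v)
      classify {e} (¬c , i) with M? e
      ... | yes me = inj₁ (me , i)
      ... | no ¬me = inj₂ ((¬me , λ cr → ¬c (¬me , cr)) , i)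

    -- If `x v` were at least X + 1, the cut degree would be at least X, and the degree of `v` at
    -- least 2X + 1, more than D + X.
    x≤X : ∀ v → x v ≤ X
    x≤X v = ≮⇒≥ λ X<x → <⇒≱ (s≤s (+-monoˡ-≤ X d<X))
      (≤-trans (+-mono-≤ X<x (s≤s⁻¹ (≤-trans X<x (x≤1+cut v)))) (degree-split v))

    cut≤ : ∀ v → cutDegree F? σ v ≤ suc d + y v
    cut≤ v = ≤-trans (m+n≤o⇒m≤o∸n _ (≤-trans (≤-reflexive (+-comm _ (x v))) (degree-split v)))
                     (≤-reflexive (+-∸-assoc (suc d) (x≤X v)))

    S? : Decidable (λ e → ¬ C e)
    S? e = ¬? (C? e)

    few : ∀ {e} → ¬ C e → M e ≢ true → # (λ f → (S? ─? e) f ×-dec adjacent? e f) < K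
    few {e} ¬c _ = begin-strict
      # (λ f → (S? ─? e) f ×-dec adjacent? e f) ≤⟨ #-⊎ _ first? second?
                                                    (λ (s , r) → Sum.map (s ,_) (proj₁ s ,_) r) ⟩
      -- The edge `e` itself is left out at its first end, which makes the bound strict.
      # first? + # second?                      <⟨ +-mono-<-≤ (<-≤-trans first< (x≤X _)) (x≤X _) ⟩
      X + X                                     ≤⟨ m≤n+m _ (suc d) ⟩
      suc d + (X + X)                           ≤⟨ K≥ ⟩
      K                                         ∎
      where
      open ≤-Reasoning
      first? : Decidable (λ f → (¬ C f × f ≢ e) × Incident G f (proj₁ (ends G e)))
      first? f = (S? ─? e) f ×-dec incident? G f (proj₁ (ends G e))
      second? : Decidable (λ f → ¬ C f × Incident G f (proj₂ (ends G e)))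
      second? f = S? f ×-dec incident? G f (proj₂ (ends G e))
      first< : # first? < x (proj₁ (ends G e))
      first< = #-strict first? (λ f → S? f ×-dec incident? G f (proj₁ (ends G e)))
                        (λ ((s , _) , i) → s , i) (¬c , inj₁ refl) (λ ((_ , ne) , _) → ne refl)

    outer = greedy Adjacent-sym adjacent? S? M? pre
              -- Arbitrary colours on `M` are proper because distinct edges of a matching are never
              -- adjacent.
              (λ me mf ne r → ⊥-elim (matching _ _ me mf ne r)) few (<-wellFounded _)
    col = proj₁ outer

    -- For an edge of `C`, `a` gives the end on the `false` side of the cut and `b` the end on the
    -- `true` side.
    a b : E → V
    a e = if σ (proj₁ (ends G e)) then proj₂ (ends G e) else proj₁ (ends G e)
    b e = if σ (proj₁ (ends G e)) then proj₁ (ends G e) else proj₂ (ends G e)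

    to-ends : ∀ e {v} → Incident G e v → a e ≡ v ⊎ b e ≡ v
    to-ends e i with σ (proj₁ (ends G e))
    ... | true  = Sum.swap i
    ... | false = i

    from-ends : ∀ e {v} → a e ≡ v ⊎ b e ≡ v → Incident G e v
    from-ends e r with σ (proj₁ (ends G e))
    ... | true  = Sum.swap r
    ... | false = r

    a-side : ∀ {e} → C e → σ (a e) ≡ false
    a-side {e} (_ , cr) with σ (proj₁ (ends G e)) in eq
    ... | true  = ¬-not (cr ∘ sym)
    ... | false = eq

    b-side : ∀ {e} → C e → σ (b e) ≡ true
    b-side {e} (_ , cr) with σ (proj₁ (ends G e)) in eq
    ... | true  = eq
    ... | false = ¬-not (cr ∘ sym)

    adjacent-at : ∀ e f → Adjacent G e f → Incident G f (a e) ⊎ Incident G f (b e)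
    adjacent-at e f r with Adjacent⇒Incident² r
    ... | v , i , i′ with to-ends e i
    ...   | inj₁ refl = inj₁ i′
    ...   | inj₂ refl = inj₂ i′

    sameEnd : ∀ {e f} → C e → C f → Adjacent G e f → SameEnd a b e f
    sameEnd {e} {f} ce cf r with Sum.map (to-ends f) (to-ends f) (adjacent-at e f r)
    ... | inj₁ (inj₁ eq) = inj₁ (sym eq)
    ... | inj₁ (inj₂ eq) = case trans (sym (b-side cf)) (trans (cong σ eq) (a-side ce)) of λ ()
    ... | inj₂ (inj₁ eq) = case trans (sym (a-side cf)) (trans (cong σ eq) (b-side ce)) of λ ()
    ... | inj₂ (inj₂ eq) = inj₂ (sym eq)

    a-bound : ∀ v → # (λ e → C? e ×-dec a e ≟ v) ≤ suc d + y v
    a-bound v = ≤-trans (#-mono (λ e → C? e ×-dec a e ≟ v) (λ e → C? e ×-dec incident? G e v)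
                          (λ {e} (ce , eq) → ce , from-ends e (inj₁ eq))) (cut≤ v)
    b-bound : ∀ v → # (λ e → C? e ×-dec b e ≟ v) ≤ suc d + y v
    b-bound v = ≤-trans (#-mono (λ e → C? e ×-dec b e ≟ v) (λ e → C? e ×-dec incident? G e v)
                          (λ {e} (ce , eq) → ce , from-ends e (inj₂ eq))) (cut≤ v)

    module U = Ranking _≟_ C? a d y a-bound
    module W = Ranking _≟_ C? b d y b-bound

    bipartite = konig U._≟ⱽᴺ_ W._≟ⱽᴺ_ (suc d) U.end W.end U.end-degree W.end-degree
    g : E → Fin (suc d)
    g = proj₁ bipartite
    g-properᵃ : ∀ {e f} → e ≢ f → U.end e ≡ U.end f → g e ≢ g f
    g-properᵃ ne = proj₂ bipartite ne ∘ inj₁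
    -- On the `b` side the order of the colours is reversed, as in Galvin's proof: an edge ranked
    -- late among main edges at one end is ranked early at the other.
    g-properᵇ : ∀ {e f} → e ≢ f → W.end e ≡ W.end f → opposite (g e) ≢ opposite (g f)
    g-properᵇ {e} {f} ne eq oeq = proj₂ bipartite ne (inj₂ eq)
      (trans (sym (opposite-involutive (g e))) (trans (cong opposite oeq) (opposite-involutive (g f))))

    Near : E → E → Set
    Near e f = ¬ C f × (Incident G f (a e) ⊎ Incident G f (b e))
    near? : ∀ e → Decidable (Near e)
    near? e f = S? f ×-dec (incident? G f (a e) ⊎-dec incident? G f (b e))

    L? : ∀ e → Decidable (λ c → ¬ Used (near? e) col c)
    L? e = ¬? ∘ used? (near? e) col

    -- The already coloured edges at the two ends block at most `x (a e) + x (b e)` of the D + 2X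
    -- colours. These two terms are added back to both sides to avoid subtraction.
    long : ∀ e → suc d + (y (a e) + y (b e)) ≤ # (L? e)
    long e = +-cancelʳ-≤ (x (a e) + x (b e)) _ _ (begin
      suc d + (y (a e) + y (b e)) + (x (a e) + x (b e))
        ≡⟨ +-assoc (suc d) _ _ ⟩
      suc d + (y (a e) + y (b e) + (x (a e) + x (b e)))
        ≡⟨ cong (suc d +_) (interchange (y (a e)) _ _ _) ⟩
      suc d + (y (a e) + x (a e) + (y (b e) + x (b e)))
        ≡⟨ cong (suc d +_) (cong₂ _+_ (m∸n+n≡m (x≤X (a e))) (m∸n+n≡m (x≤X (b e)))) ⟩
      suc d + (X + X)
        ≤⟨ K≥ ⟩
      K
        ≤⟨ #-unused (near? e) col ⟩
      # (L? e) + # (near? e)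
        ≤⟨ +-monoʳ-≤ (# (L? e)) (#-⊎ (near? e) (λ f → S? f ×-dec incident? G f (a e))
             (λ f → S? f ×-dec incident? G f (b e)) (λ (s , r) → Sum.map (s ,_) (s ,_) r)) ⟩
      # (L? e) + (x (a e) + x (b e)) ∎)
      where open ≤-Reasoning

    open Galvin _≟_ _≟_ a b (U.rank g g-properᵃ) (W.rank (opposite ∘ g) g-properᵇ)
                (U.rank-inj g g-properᵃ) (W.rank-inj (opposite ∘ g) g-properᵇ)

    -- The colour indices `g e` and `opposite (g e)` add up to `d` whatever `g e` is, one less than
    -- the D in `long`.
    short : ∀ {e} → C e → # (betterᵃ? C? e) + # (betterᵇ? C? e) < # (L? e)
    short {e} _ = begin-strict
      # (betterᵃ? C? e) + # (betterᵇ? C? e)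
        ≤⟨ +-mono-≤ (U.rank-bound g g-properᵃ e) (W.rank-bound (opposite ∘ g) g-properᵇ e) ⟩
      y (a e) + toℕ (g e) + (y (b e) + toℕ (opposite (g e)))
        ≡⟨ interchange (y (a e)) _ _ _ ⟩
      y (a e) + y (b e) + (toℕ (g e) + toℕ (opposite (g e)))
        ≡⟨ cong (λ z → y (a e) + y (b e) + (toℕ (g e) + z)) (opposite-prop (g e)) ⟩
      y (a e) + y (b e) + (toℕ (g e) + (d ∸ toℕ (g e)))
        ≡⟨ cong (y (a e) + y (b e) +_) (m+[n∸m]≡n (s≤s⁻¹ (toℕ<n (g e)))) ⟩
      y (a e) + y (b e) + d
        ≡⟨ +-comm (y (a e) + y (b e)) d ⟩
      d + (y (a e) + y (b e))
        <⟨ n<1+n _ ⟩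
      suc d + (y (a e) + y (b e))
        ≤⟨ long e ⟩
      # (L? e) ∎
      where open ≤-Reasoning

    cross = listColouring K C? L? short

    c : E → Fin K
    c e with C? e
    ... | yes ce = proj₁ cross e ce
    ... | no _   = col e

    mixed : ∀ {e f} (ce : C e) → ¬ C f → Adjacent G e f → col f ≢ proj₁ cross e ce
    -- The list of `e` excludes every colour used by `col` on edges outside `C` that meet `e`.
    mixed {e} {f} ce ¬cf r eq = proj₁ (proj₂ cross) ce (f , (¬cf , adjacent-at e f r) , eq)

    c-proper : IsProper G c
    c-proper e f ne r with C? e | C? f
    ... | yes ce | yes cf = proj₂ (proj₂ cross) ce cf ne (sameEnd ce cf r)
    ... | yes ce | no ¬cf = mixed ce ¬cf r ∘ sym
    ... | no ¬ce | yes cf = mixed cf ¬ce (Adjacent-sym {e} {f} r)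
    ... | no ¬ce | no ¬cf = proj₁ (proj₂ outer) ¬ce ¬cf ne r

    c-pre : ∀ e → M e ≡ true → c e ≡ pre e
    c-pre e me with C? e
    ... | yes (¬me , _) = ⊥-elim (¬me me)
    ... | no _          = proj₂ (proj₂ outer) me

-- Size of the palette and conclusion

-- Here `d` is D itself. After doubling, the claim is 2d + 4X ≤ 3d + 3X + 1, that is X ≤ d + 1; the
-- added 1 under the floor pays for odd maximum degree.
palette-bound : ∀ d X → X ≤ suc d → d + (X + X) ≤ (3 * (d + X) + 1) / 2
palette-bound d X le = begin
  d + (X + X)                      ≡⟨ m*n/n≡m (d + (X + X)) 2 ⟨
  (d + (X + X)) * 2 / 2            ≤⟨ /-monoˡ-≤ 2 (begin
    (d + (X + X)) * 2                ≡⟨ solve 2 (λ d X → (d :+ (X :+ X)) :* con 2 := con 2 :* d :+ con 3 :* X :+ X) refl d X ⟩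
    2 * d + 3 * X + X                ≤⟨ +-monoʳ-≤ (2 * d + 3 * X) le ⟩
    2 * d + 3 * X + suc d            ≡⟨ solve 2 (λ d X → con 2 :* d :+ con 3 :* X :+ (con 1 :+ d) := con 3 :* (d :+ X) :+ con 1) refl d X ⟩
    3 * (d + X) + 1                  ∎) ⟩
  (3 * (d + X) + 1) / 2            ∎
  where
  open ≤-Reasoning
  open +-*-Solver

theorem1p6 : (G : Multigraph) (M : EdgeSet G) → IsMatching G M →
    (pre : Fin (m G) → Fin (paletteSize G)) →
    Σ (EdgeColouring G (paletteSize G)) (λ c →
    IsProper G c × ((e : Fin (m G)) → M e ≡ true → c e ≡ pre e))
theorem1p6 G M matching pre with maxDegree G ≤? 1
-- As `pre` is defined on all edges and no two distinct edges are adjacent, it is already proper.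
... | yes Δ≤1 = pre , (λ e f ne r → ⊥-elim (maxDegree≤1⇒nonadjacent G Δ≤1 ne r)) , λ _ _ → refl
... | no Δ≰1 = main (maxDegree G) refl (≰⇒> Δ≰1)
  where
  main : ∀ Δ → maxDegree G ≡ Δ → 1 < Δ →
         ∃ λ (c : EdgeColouring G (paletteSize G)) → IsProper G c × (∀ e → M e ≡ true → c e ≡ pre e)
  main (suc (suc Δ)) eq (s≤s (s≤s _)) =
    -- The maximum degree is `suc (suc Δ)`, so its lower and upper halves are `suc ⌊ Δ /2⌋` and
    -- `suc ⌈ Δ /2⌉`.
    extendPrecolouring G ⌊ Δ /2⌋ (suc ⌈ Δ /2⌉)
      (λ v → ≤-trans (degree≤maxDegree G v) (≤-reflexive sum≡))
      (s≤s (⌊n/2⌋≤⌈n/2⌉ Δ))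
      -- By definition `⌈ Δ /2⌉` is `⌊ suc Δ /2⌋`, which is at most `⌊ suc (suc Δ) /2⌋`, that is
      -- `suc ⌊ Δ /2⌋`.
      (≤-trans (palette-bound (suc ⌊ Δ /2⌋) (suc ⌈ Δ /2⌉) (s≤s (⌊n/2⌋-mono (n≤1+n (suc Δ)))))
               (≤-reflexive (cong (λ z → (3 * z + 1) / 2) (sym sum≡))))
      M matching pre
    where
    sum≡ : maxDegree G ≡ suc ⌊ Δ /2⌋ + suc ⌈ Δ /2⌉
    sum≡ = trans eq (cong suc (trans (cong suc (sym (⌊n/2⌋+⌈n/2⌉≡n Δ))) (sym (+-suc _ _))))
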